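{- Suppose $\kappa$ is an uncountable cardinal. If $\mathsf{BA}^-_\kappa$ holds, then $2^{\aleph_0} = 2^{\kappa}$.
   Context: All topological spaces are assumed separable and metrizable. A nonempty space is $\kappa$-crowded if every nonempty open subset has size $\kappa$. A space is zero-dimensional if it has a basis of clopen sets. For a cardinal $\kappa \le 2^{\aleph_0}$, $\mathsf{BA}^-_\kappa$ is the statement that every pair of zero-dimensional, $\kappa$-crowded spaces are homeomorphic. -}

-- A cardinal is represented by a type, compared with others by injections and
-- bijections for propositional equality.  A subset of X is a predicate
-- Pred X 0ℓ, taken up to _≐_.  The definitions are meant to be read
-- classically, i.e. in the presence of excluded middle and function
-- extensionality.

module Defs where

open import Level using (0ℓ)
open import Data.Nat.Base using (ℕ)
open import Data.Product using (_×_; _,_; ∃-syntax)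
open import Data.Rational using (ℚ; 0ℚ; 1ℚ; _<_; _+_; _-_; -_)
open import Data.Rational.Properties
  using (+-monoʳ-<; +-monoˡ-<; +-mono-<; +-comm; +-assoc; +-inverseˡ; +-inverseʳ; +-identityʳ;
         <-trans; <-irrefl; <-dense; <-cmp; negative⁻¹)
open import Data.Refinement using (Refinement)
open import Function.Bundles using (_↔_; _↣_; _⇔_; module Inverse)
open import Relation.Binary.Core using (Rel)
open import Relation.Binary.Definitions using (_Respects_; tri<; tri≈; tri>)
open import Relation.Binary.PropositionalEquality
  using (_≡_; refl; sym; cong; subst; module ≡-Reasoning)
open import Relation.Nullary using (¬_; contradiction)
open import Relation.Unary using (Pred; _∈_; _∉_; _⊆_; _≐_; _∩_; _⊢_; ∁; ∅; U; ⋃; Satisfiable)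
import Function.Metric.Structures as Metric

-- A real number is the lower half of a Dedekind cut of ℚ.

record ℝ : Set₁ where
  field
    lower      : Pred ℚ 0ℓ
    inhabited  : Satisfiable lower
    proper     : ∃[ q ] q ∉ lower
    downClosed : ∀ {p q} → p < q → q ∈ lower → p ∈ lower
    noMaximum  : ∀ {p} → p ∈ lower → ∃[ q ] p < q × q ∈ lower

open ℝ

infix 4 _≈ᵣ_ _≤ᵣ_ _<ᵣ_
infixl 6 _+ᵣ_

_≈ᵣ_ _≤ᵣ_ _<ᵣ_ : Rel ℝ 0ℓ
x ≈ᵣ y = lower x ≐ lower y
x ≤ᵣ y = lower x ⊆ lower y
x <ᵣ y = ∃[ q ] q ∈ lower y × q ∉ lower x

0ᵣ : ℝ
0ᵣ = record
  { lower      = _< 0ℚ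
  ; inhabited  = - 1ℚ , negative⁻¹ (- 1ℚ)
  ; proper     = 0ℚ , <-irrefl refl
  ; downClosed = <-trans
  ; noMaximum  = λ p<0 → let (q , p<q , q<0) = <-dense p<0 in q , p<q , q<0
  }

private
  r+[p-r]≡p : ∀ p r → r + (p - r) ≡ p
  r+[p-r]≡p p r = begin
    r + (p - r)      ≡⟨ +-comm r (p - r) ⟩
    (p - r) + r      ≡⟨ +-assoc p (- r) r ⟩
    p + (- r + r)    ≡⟨ cong (p +_) (+-inverseˡ r) ⟩
    p + 0ℚ           ≡⟨ +-identityʳ p ⟩
    p                ∎
    where open ≡-Reasoning

  [r+s]-r≡s : ∀ r s → (r + s) - r ≡ s
  [r+s]-r≡s r s = begin
    (r + s) - r      ≡⟨ cong (_- r) (+-comm r s) ⟩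
    (s + r) - r      ≡⟨ +-assoc s r (- r) ⟩
    s + (r - r)      ≡⟨ cong (s +_) (+-inverseʳ r) ⟩
    s + 0ℚ           ≡⟨ +-identityʳ s ⟩
    s                ∎
    where open ≡-Reasoning

  below : ∀ (x : ℝ) {a r} → a ∉ lower x → r ∈ lower x → r < a
  below x {a} {r} a∉x r∈x with <-cmp r a
  ... | tri< r<a _ _  = r<a
  ... | tri≈ _ refl _ = contradiction r∈x a∉x
  ... | tri> _ _ a<r  = contradiction (downClosed x a<r r∈x) a∉x

_+ᵣ_ : ℝ → ℝ → ℝ
x +ᵣ y = record
  { lower      = λ q → ∃[ r ] ∃[ s ] r ∈ lower x × s ∈ lower y × q ≡ r + s
  ; inhabited  = let (r , r∈x) = inhabited x
                     (s , s∈y) = inhabited y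
                 in r + s , r , s , r∈x , s∈y , refl
  ; proper     = let (a , a∉x) = proper x
                     (b , b∉y) = proper y
                 in a + b , λ (r , s , r∈x , s∈y , a+b≡r+s) →
                      <-irrefl (sym a+b≡r+s) (+-mono-< (below x a∉x r∈x) (below y b∉y s∈y))
  ; downClosed = λ { {p} p<r+s (r , s , r∈x , s∈y , refl) →
                      r , p - r , r∈x
                    , downClosed y (subst (p - r <_) ([r+s]-r≡s r s) (+-monoˡ-< (- r) p<r+s)) s∈y
                    , sym (r+[p-r]≡p p r) }
  ; noMaximum  = λ { (r , s , r∈x , s∈y , refl) →
                      let (s′ , s<s′ , s′∈y) = noMaximum y s∈y
                      in r + s′ , +-monoʳ-< r s<s′ , r , s′ , r∈x , s′∈y , refl }
  }

record Space : Set₁ where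
  field
    Carrier : Set
    Open    : Pred (Pred Carrier 0ℓ) 0ℓ
    Open-≐  : Open Respects _≐_
    Open-∅  : Open ∅
    Open-U  : Open U
    Open-∩  : ∀ {V W} → Open V → Open W → Open (V ∩ W)
    Open-⋃  : ∀ {I : Set} {V : I → Pred Carrier 0ℓ} → (∀ i → Open (V i)) → Open (⋃ I V)

open Space

-- Finite types count as countable.

Countable : Set → Set
Countable A = A ↣ ℕ

Separable : Space → Set₁
Separable X = ∃[ D ] Countable (Refinement (Carrier X) D)
                   × (∀ V → Open X V → Satisfiable V → Satisfiable (D ∩ V))

IsMetric : {A : Set} → (A → A → ℝ) → Set₁
IsMetric = Metric.IsGeneralMetric _≡_ _≈ᵣ_ _≤ᵣ_ 0ᵣ _+ᵣ_

Metrizable : Space → Set₁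
Metrizable X = ∃[ d ] IsMetric d
                    × (∀ V → Open X V ⇔ (∀ x → x ∈ V → ∃[ ε ] 0ᵣ <ᵣ ε × (λ y → d x y <ᵣ ε) ⊆ V))

Clopen : (X : Space) → Pred (Pred (Carrier X) 0ℓ) 0ℓ
Clopen X V = Open X V × Open X (∁ V)

IsBasis : (X : Space) → Pred (Pred (Carrier X) 0ℓ) 0ℓ → Set₁
IsBasis X ℬ = ℬ ⊆ Open X
            × (∀ V → Open X V → ∀ x → x ∈ V → ∃[ B ] B ∈ ℬ × x ∈ B × B ⊆ V)

ZeroDimensional : Space → Set₁
ZeroDimensional X = ∃[ ℬ ] IsBasis X ℬ × ℬ ⊆ Clopen X

-- Refinement has proof-irrelevant membership proofs, so that its elements are
-- exactly the points of V.

Crowded : Set → Space → Set₁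
Crowded κ X = Carrier X
            × (∀ V → Open X V → Satisfiable V → Refinement (Carrier X) V ↔ κ)

Continuous : (X Y : Space) → (Carrier X → Carrier Y) → Set₁
Continuous X Y f = ∀ V → Open Y V → Open X (f ⊢ V)

record Homeomorphic (X Y : Space) : Set₁ where
  field
    bijection       : Carrier X ↔ Carrier Y
    to-continuous   : Continuous X Y (Inverse.to bijection)
    from-continuous : Continuous Y X (Inverse.from bijection)

-- Separability and metrizability are part of what is meant by a space in BA⁻:
-- they are standing assumptions on all spaces, not hypotheses special to BA⁻.

record IsBASpace (κ : Set) (X : Space) : Set₁ where
  field
    separable       : Separable X
    metrizable      : Metrizable X
    zeroDimensional : ZeroDimensional X
    crowded         : Crowded κ X

BA⁻ : Set → Set₁
BA⁻ κ = ∀ X Y → IsBASpace κ X → IsBASpace κ Y → Homeomorphic X Y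

{-# OPTIONS --safe #-}

-- For A ⊆ κ let X_A be a subspace of ℕ^ℕ made of κ points through every finite
-- sequence, together with one further point for each element of A.  Every X_A is
-- κ-crowded, which requires ℕ × κ to have size κ.  By BA⁻ there are
-- homeomorphisms X_κ → X_A.  As a map into ℕ^ℕ, each is determined by its values
-- on a countable dense subset of X_κ, and its image X_A determines A.  Hence
-- 2^κ ≤ (ℕ^ℕ)^ℕ = 2^ℕ.  Excluded middle is assumed for all types, not only for
-- propositions, and therefore serves as a choice principle.

module Submission where

open import Defs
open import Level using (0ℓ; suc; lift; lower)
open import Data.Bool.Base using (Bool; true; false; T; if_then_else_)
open import Data.Bool.Properties using (T-irrelevant; T-≡) renaming (_≟_ to _≟ᵇ_)
open import Data.Empty using (⊥)
open import Data.Fin.Base using (toℕ)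
open import Data.Fin.Properties using (toℕ-injective)
open import Data.Integer.Base as ℤ using (+_; +≤+; +[1+_])
open import Data.Integer.Properties using (*-monoˡ-≤-nonNeg; *-monoʳ-≤-nonNeg)
open import Data.List.Base using (List; []; _∷_; length; lookup)
open import Data.List.Membership.Propositional using () renaming (_∈_ to _∈ₗ_; _∉_ to _∉ₗ_)
open import Data.List.Relation.Unary.Any as Any using (here; there)
open import Data.List.Relation.Unary.Any.Properties using (lookup-index)
open import Data.Nat.Base as ℕ using (ℕ; zero; _+_; _*_; _<_; _≤_; z≤n; s≤s; _⊔_)
open import Data.Nat.Coprimality using (1-coprimeTo)
open import Data.Nat.Properties
  using (_≟_; _<?_; <-cmp; ≮⇒≥; m<1+n⇒m<n∨m≡n; *-cancelˡ-≡; even≢odd; suc-injective;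
         +-comm; <⇒≤; <-≤-trans; ≤-refl; m<n⇒m<1+n; m≤m⊔n; m≤n⊔m)
open import Data.Product using (_×_; _,_; proj₁; proj₂; Σ; ∃; ∃-syntax; map₂)
open import Data.Rational as ℚ using (ℚ; mkℚ; 0ℚ; 1ℚ; *≤*)
import Data.Rational.Properties as ℚ
open import Data.Refinement using (Refinement; _,_; value; value-injective)
open import Data.Irrelevant using ([_])
open import Data.Sum.Base as Sum using (_⊎_; inj₁; inj₂; [_,_]′; fromInj₁)
open import Function.Base using (_∘_; id)
open import Function.Bundles
  using (_↔_; _↣_; mk↣; mk↔ₛ′; mk⇔; module Injection; module Inverse; module Equivalence)
open import Function.Construct.Composition using (_↣-∘_)
open import Relation.Binary.Definitions using (tri<; tri≈; tri>)
open import Relation.Binary.PropositionalEquality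
  using (_≡_; _≢_; refl; sym; trans; cong; cong₂; cong-app; subst; isEquivalence; module ≡-Reasoning)
open import Relation.Nullary using (¬_; yes; no; contradiction; recompute)
open import Relation.Nullary.Decidable
  using (decidable-stable; isYes; map′; True; toWitness; fromWitness)
open import Relation.Unary using (Pred; _∈_; _∉_; _⊆_; Satisfiable)
open import Axiom.ExcludedMiddle using (ExcludedMiddle)
open import Axiom.UniquenessOfIdentityProofs using (module Decidable⇒UIP)
open import Axiom.Extensionality.Propositional using (Extensionality)

open Injection using (to; injective)

-- Codings by natural numbers, and finite prefixes of sequences.

opaque

  -- This is 2^a (2b + 1).
  pair : ℕ → ℕ → ℕ
  pair zero      b = ℕ.suc (2 * b)
  pair (ℕ.suc a) b = 2 * pair a b

  pair-injective : ∀ {a b a′ b′} → pair a b ≡ pair a′ b′ → a ≡ a′ × b ≡ b′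
  pair-injective {zero} {b} {zero} eq = refl , *-cancelˡ-≡ _ _ 2 (suc-injective eq)
  pair-injective {zero} {b} {ℕ.suc a′} {b′} eq = contradiction (sym eq) (even≢odd (pair a′ b′) b)
  pair-injective {ℕ.suc a} {b} {zero} {b′} eq = contradiction eq (even≢odd (pair a b) b′)
  pair-injective {ℕ.suc a} {b} {ℕ.suc a′} {b′} eq =
    let a≡a′ , b≡b′ = pair-injective {a} {b} {a′} {b′} (*-cancelˡ-≡ _ _ 2 eq)
    in cong ℕ.suc a≡a′ , b≡b′

code : List ℕ → ℕ
code []      = 0
code (a ∷ s) = ℕ.suc (pair a (code s))

code-injective : ∀ {s t} → code s ≡ code t → s ≡ t
code-injective {[]}    {[]}    _  = refl
code-injective {a ∷ s} {b ∷ t} eq =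
  let a≡b , s≡t = pair-injective (suc-injective eq)
  in cong₂ _∷_ a≡b (code-injective s≡t)

bool-ext : ∀ {a b} → (a ≡ true → b ≡ true) → (b ≡ true → a ≡ true) → a ≡ b
bool-ext {true}  {true}  _ _ = refl
bool-ext {false} {false} _ _ = refl
bool-ext {true}  {false} f _ = sym (f refl)
bool-ext {false} {true}  _ g = g refl

bit : Bool → ℕ
bit b = if b then 1 else 0

bit-injective : ∀ {a b} → bit a ≡ bit b → a ≡ b
bit-injective {true}  {true}  _ = refl
bit-injective {false} {false} _ = refl

infixr 5 _⌢_

_⌢_ : List ℕ → (ℕ → ℕ) → ℕ → ℕ
([] ⌢ g)      j         = g j
((a ∷ s) ⌢ g) zero      = a
((a ∷ s) ⌢ g) (ℕ.suc j) = (s ⌢ g) j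

⌢-drop : ∀ s g j → (s ⌢ g) (length s + j) ≡ g j
⌢-drop []      g j = refl
⌢-drop (_ ∷ s) g j = ⌢-drop s g j

prefix : ℕ → (ℕ → ℕ) → List ℕ
prefix zero      x = []
prefix (ℕ.suc n) x = x 0 ∷ prefix n (x ∘ ℕ.suc)

prefix-⌢ : ∀ {n} x g j → j < n → x j ≡ (prefix n x ⌢ g) j
prefix-⌢ x g zero      (s≤s _)   = refl
prefix-⌢ x g (ℕ.suc j) (s≤s j<n) = prefix-⌢ (x ∘ ℕ.suc) g j j<n

-- Small positive rationals and reals.

-- The number is 1/(n+1): `mkℚ` stores the denominator minus one.
recip : ℕ → ℚ
recip n = mkℚ (+ 1) n (1-coprimeTo (ℕ.suc n))

0<recip : ∀ n → 0ℚ ℚ.< recip n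
0<recip n = ℚ.positive⁻¹ (recip n)

recip-antitone : ∀ {m n} → m ≤ n → recip n ℚ.≤ recip m
recip-antitone m≤n = *≤* (*-monoˡ-≤-nonNeg (+ 1) (+≤+ (s≤s m≤n)))

-- A positive rational with denominator d+1 is at least 1/(d+1).
recip-archimedean : ∀ {q} → 0ℚ ℚ.< q → ∃[ n ] recip n ℚ.≤ q
recip-archimedean {mkℚ +[1+ a ] d _} _ =
  d , *≤* (*-monoʳ-≤-nonNeg (+ ℕ.suc d) (+≤+ (s≤s (z≤n {a}))))
recip-archimedean {mkℚ (+ 0) d c} 0<q with () ← ℚ.positive {mkℚ (+ 0) d c} 0<q
recip-archimedean {mkℚ (ℤ.-[1+ a ]) d c} 0<q with () ← ℚ.positive {mkℚ (ℤ.-[1+ a ]) d c} 0<q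

recipᵣ : ℕ → ℝ
recipᵣ n = record
  { lower      = ℚ._< recip n
  ; inhabited  = 0ℚ , 0<recip n
  ; proper     = recip n , ℚ.<-irrefl refl
  ; downClosed = ℚ.<-trans
  ; noMaximum  = λ p<r → let q , p<q , q<r = ℚ.<-dense p<r in q , p<q , q<r
  }

-- The topology pulled back from Baire space, and its metric.

module Induced {X : Set} (ι : X → ℕ → ℕ) where

  Agree : ℕ → X → X → Set
  Agree n x y = ∀ j → j < n → ι x j ≡ ι y j

  Agree-mono : ∀ {m n x y} → m ≤ n → Agree n x y → Agree m x y
  Agree-mono m≤n x~y j j<m = x~y j (<-≤-trans j<m m≤n)

  Agree-trans : ∀ {n x y z} → Agree n x y → Agree n y z → Agree n x z
  Agree-trans x~y y~z j j<n = trans (x~y j j<n) (y~z j j<n)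

  Agree-sym : ∀ {n x y} → Agree n x y → Agree n y x
  Agree-sym x~y j j<n = sym (x~y j j<n)

  space : Space
  space = record
    { Carrier = X
    ; Open    = λ V → ∀ x → x ∈ V → ∃[ n ] (∀ y → Agree n x y → y ∈ V)
    ; Open-≐  = λ (V⊆W , W⊆V) V-open x x∈W →
                  let n , c = V-open x (W⊆V x∈W) in n , λ y x~y → V⊆W (c y x~y)
    ; Open-∅  = λ _ ()
    ; Open-U  = λ _ _ → 0 , λ _ _ → _
    ; Open-∩  = λ V-open W-open x (x∈V , x∈W) →
                  let m , c = V-open x x∈V
                      n , d = W-open x x∈W
                  in m ⊔ n , λ y x~y → c y (Agree-mono (m≤m⊔n m n) x~y)
                                     , d y (Agree-mono (m≤n⊔m m n) x~y)
    ; Open-⋃  = λ V-open x (i , x∈V) →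
                  let n , c = V-open i x x∈V in n , λ y x~y → i , c y x~y
    }

  open Space space using (Open)

  cylinder-open : ∀ n x → Open (Agree n x)
  cylinder-open n x y x~y = n , λ z y~z → Agree-trans x~y y~z

  zeroDimensional : ZeroDimensional space
  zeroDimensional = Clopen space , (proj₁ , refine) , id
    where
    refine : ∀ V → Open V → ∀ x → x ∈ V → ∃[ B ] B ∈ Clopen space × x ∈ B × B ⊆ V
    refine V V-open x x∈V =
      let n , c = V-open x x∈V
      in Agree n x
       , ( cylinder-open n x
         -- Agreement up to `n` is an equivalence relation, so the complement of one class is a
         -- union of classes.
         , λ y x≁y → n , λ z y~z x~z → x≁y (Agree-trans x~z (Agree-sym y~z)))
       , (λ _ _ → refl)
       , λ {y} x~y → c y x~y

  module _ (ι-injective : ∀ {x y} → (∀ j → ι x j ≡ ι y j) → x ≡ y) where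

    -- The supremum of 0 and of all 1/(n+1) such that x and y differ at n.

    dist : X → X → ℝ
    dist x y = record
      { lower      = λ q → q ℚ.< 0ℚ ⊎ ∃[ n ] ι x n ≢ ι y n × q ℚ.< recip n
      ; inhabited  = ℚ.- 1ℚ , inj₁ (ℚ.negative⁻¹ (ℚ.- 1ℚ))
      ; proper     = 1ℚ , λ where
          (inj₁ 1<0)           → ℚ.<-asym 1<0 (0<recip 0)
          (inj₂ (n , _ , 1<r)) → ℚ.<-irrefl refl (ℚ.<-≤-trans 1<r (recip-antitone z≤n))
      ; downClosed = λ p<q → Sum.map (ℚ.<-trans p<q) (map₂ (map₂ (ℚ.<-trans p<q)))
      ; noMaximum  = λ where
          (inj₁ p<0) → let q , p<q , q<0 = ℚ.<-dense p<0 in q , p<q , inj₁ q<0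
          (inj₂ (n , x≢y , p<r)) →
            let q , p<q , q<r = ℚ.<-dense p<r in q , p<q , inj₂ (n , x≢y , q<r)
      }

    -- A difference at some j < n would put every rational below 1/(j+1), hence `q`, under the
    -- distance.
    ∉dist⇒Agree : ∀ {q n x y} → q ℚ.< recip n → q ∉ ℝ.lower (dist x y) → Agree n x y
    ∉dist⇒Agree {x = x} {y} q<r q∉d j j<n = decidable-stable (ι x j ≟ ι y j) λ x≢y →
      q∉d (inj₂ (j , x≢y , ℚ.<-≤-trans q<r (recip-antitone (<⇒≤ j<n))))

    Agree⇒∉dist : ∀ {q n x y} → 0ℚ ℚ.< q → recip n ℚ.≤ q → Agree n x y → q ∉ ℝ.lower (dist x y)
    Agree⇒∉dist 0<q r≤q x~y (inj₁ q<0) = ℚ.<-asym 0<q q<0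
    Agree⇒∉dist {n = n} 0<q r≤q x~y (inj₂ (j , x≢y , q<rⱼ)) with j <? n
    ... | yes j<n = x≢y (x~y j j<n)
    ... | no  j≮n = ℚ.<-irrefl refl
      (ℚ.<-≤-trans q<rⱼ (ℚ.≤-trans (recip-antitone (≮⇒≥ j≮n)) r≤q))

    0≤dist : ∀ {x y} → 0ᵣ ≤ᵣ dist x y
    0≤dist = inj₁

    -- As `u` has no maximum, p = q + (p - q) with `q` in `u` above `p`; the negative summand lies
    -- in `v`.
    add-≤ : ∀ u v → 0ᵣ ≤ᵣ v → u ≤ᵣ u +ᵣ v
    add-≤ u v 0≤v {p} p∈u =
      let q , p<q , q∈u = ℝ.noMaximum u p∈u
      in q , p ℚ.- q , q∈u
       , 0≤v (subst (p ℚ.- q ℚ.<_) (ℚ.+-inverseʳ q) (ℚ.+-monoˡ-< (ℚ.- q) p<q))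
       , sym (trans (cong (q ℚ.+_) (ℚ.+-comm p (ℚ.- q)))
             (trans (sym (ℚ.+-assoc q (ℚ.- q) p))
             (trans (cong (ℚ._+ p) (ℚ.+-inverseʳ q)) (ℚ.+-identityˡ p))))

    +ᵣ-comm-≤ : ∀ u v → u +ᵣ v ≤ᵣ v +ᵣ u
    +ᵣ-comm-≤ u v (r , s , r∈u , s∈v , eq) = s , r , s∈v , r∈u , trans eq (ℚ.+-comm r s)

    dist-isMetric : IsMetric dist
    dist-isMetric = record
      { isSemiMetric = record
        { isQuasiSemiMetric = record
          { isPreMetric = record
            { isProtoMetric = record
              { isPartialOrder = record
                { isPreorder = record
                  { isEquivalence = record
                    { refl  = id , id
                    ; sym   = λ (f , g) → g , f
                    ; trans = λ (f , g) (f′ , g′) → f′ ∘ f , g ∘ g′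
                    }
                  ; reflexive = proj₁
                  ; trans     = λ f g → g ∘ f
                  }
                ; antisym = _,_
                }
              ; ≈-isEquivalence = isEquivalence
              ; cong            = λ { refl refl → id , id }
              ; nonNegative     = 0≤dist
              }
            ; ≈⇒0 = λ { refl → [ id , (λ (_ , x≢x , _) → contradiction refl x≢x) ]′ , inj₁ }
            }
          ; 0⇒≈ = λ {x} {y} (d≤0 , _) → ι-injective λ j → decidable-stable (ι x j ≟ ι y j) λ x≢y →
              ℚ.<-irrefl refl (d≤0 (inj₂ (j , x≢y , 0<recip j)))
          }
        ; sym = λ x y → Sum.map₂ (map₂ λ (x≢y , q<r) → x≢y ∘ sym , q<r)
                      , Sum.map₂ (map₂ λ (x≢y , q<r) → x≢y ∘ sym , q<r)
        }
      ; triangle = triangle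
      }
      where
      -- The distance is an ultrametric: a coordinate separating `x` from `z` separates `x` from `y`
      -- or `y` from `z`. One summand thus suffices, and the other is nonnegative.
      triangle : ∀ x y z → dist x z ≤ᵣ dist x y +ᵣ dist y z
      triangle x y z (inj₁ q<0) =
        add-≤ (dist x y) (dist y z) 0≤dist (0≤dist {x} {y} q<0)
      triangle x y z (inj₂ (n , x≢z , q<r)) with ι x n ≟ ι y n
      ... | no  x≢y = add-≤ (dist x y) (dist y z) 0≤dist (inj₂ (n , x≢y , q<r))
      ... | yes x≡y = +ᵣ-comm-≤ (dist y z) (dist x y)
        (add-≤ (dist y z) (dist x y) 0≤dist (inj₂ (n , x≢z ∘ trans x≡y , q<r)))

    metrizable : Metrizable space
    metrizable = dist , dist-isMetric , λ V → mk⇔ (ball-in V) (cylinder-in V)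
      where
      Balls : Pred X 0ℓ → Set₁
      Balls V = ∀ x → x ∈ V → ∃[ ε ] 0ᵣ <ᵣ ε × (λ y → dist x y <ᵣ ε) ⊆ V

      ball-in : ∀ V → Open V → Balls V
      ball-in V V-open x x∈V =
        let n , c = V-open x x∈V
        in recipᵣ n , (0ℚ , 0<recip n , ℚ.<-irrefl refl)
         , λ {y} (q , q<r , q∉d) → c y (∉dist⇒Agree q<r q∉d)

      cylinder-in : ∀ V → Balls V → Open V
      cylinder-in V balls x x∈V =
        let ε , (q , q∈ε , q≮0) , ball⊆V = balls x x∈V
            -- The given `q` is only nonnegative; the Archimedean property needs a strictly positive
            -- rational.
            p , q<p , p∈ε = ℝ.noMaximum ε q∈ε
            0<p = ℚ.≤-<-trans (ℚ.≮⇒≥ q≮0) q<p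
            n , r≤p = recip-archimedean 0<p
        in n , λ y x~y → ball⊆V (p , p∈ε , Agree⇒∉dist 0<p r≤p x~y)

-- Classical comparison of cardinalities.

module _ (em₁ : ExcludedMiddle (suc 0ℓ)) (ext : Extensionality 0ℓ 0ℓ) where

  em : ExcludedMiddle 0ℓ
  em = map′ lower lift em₁

  χ : Set → Bool
  χ P = isYes (em {P})

  χ-intro : ∀ {P} → P → χ P ≡ true
  χ-intro = Equivalence.to T-≡ ∘ fromWitness

  χ-elim : ∀ {P} → χ P ≡ true → P
  χ-elim = toWitness ∘ Equivalence.from T-≡

  module _ {A B : Set} (f : A ↣ B) (g : B ↣ A) where

    -- The points whose backward orbit under `f` and `g` ends in `A`. The bijection is `f` on them
    -- and the inverse of `g` elsewhere.
    data Stopper : A → Set where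
      start : ∀ {x} → (∀ y → to g y ≢ x) → Stopper x
      step  : ∀ {w x} → Stopper w → to g (to f w) ≡ x → Stopper x

    Match : A → B → Set
    Match x y = Stopper x × to f x ≡ y ⊎ ¬ Stopper x × to g y ≡ x

    functional : ∀ {x y y′} → Match x y → Match x y′ → y ≡ y′
    functional (inj₁ (_ , p)) (inj₁ (_ , q)) = trans (sym p) q
    functional (inj₁ (s , _)) (inj₂ (¬s , _)) = contradiction s ¬s
    functional (inj₂ (¬s , _)) (inj₁ (s , _)) = contradiction s ¬s
    functional (inj₂ (_ , p)) (inj₂ (_ , q)) = injective g (trans p (sym q))

    cofunctional : ∀ {x x′ y} → Match x y → Match x′ y → x ≡ x′
    cofunctional (inj₁ (_ , p)) (inj₁ (_ , q)) = injective f (trans p (sym q))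
    cofunctional (inj₁ (s , p)) (inj₂ (¬s , q)) = contradiction (step s (trans (cong (to g) p) q)) ¬s
    cofunctional (inj₂ (¬s , q)) (inj₁ (s , p)) = contradiction (step s (trans (cong (to g) p) q)) ¬s
    cofunctional (inj₂ (_ , p)) (inj₂ (_ , q)) = trans (sym p) q

    image : ∀ x → ∃[ y ] Match x y
    image x with em {Stopper x} | em {∃[ y ] to g y ≡ x}
    ... | yes s | _            = to f x , inj₁ (s , refl)
    ... | no ¬s | yes (y , eq) = y , inj₂ (¬s , eq)
    ... | no ¬s | no ¬y        = contradiction (start λ y eq → ¬y (y , eq)) ¬s

    preimage : ∀ y → ∃[ x ] Match x y
    preimage y with em {Stopper (to g y)}
    ... | yes (start y∉)  = contradiction refl (y∉ y)
    ... | yes (step s eq) = _ , inj₁ (s , injective g eq)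
    ... | no ¬s           = to g y , inj₂ (¬s , refl)

    cantorSchröderBernstein : A ↔ B
    cantorSchröderBernstein = mk↔ₛ′ (proj₁ ∘ image) (proj₁ ∘ preimage)
      (λ y → functional (proj₂ (image _)) (proj₂ (preimage y)))
      (λ x → cofunctional (proj₂ (preimage _)) (proj₂ (image x)))

  Bool^-mono : {A B : Set} → A ↣ B → (A → Bool) ↣ (B → Bool)
  Bool^-mono {A} {B} e = mk↣ {to = extend} λ F≡G → ext λ a →
      bool-ext (agree (cong-app F≡G) a) (agree (cong-app (sym F≡G)) a)
    where
    extend : (A → Bool) → B → Bool
    extend F b = χ (∃[ a ] to e a ≡ b × F a ≡ true)

    agree : ∀ {F G} → (∀ b → extend F b ≡ extend G b) → ∀ a → F a ≡ true → G a ≡ true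
    agree {G = G} F≡G a Fa with a′ , a′≡a , Ga′ ← χ-elim (trans (sym (F≡G (to e a))) (χ-intro (a , refl , Fa))) =
      subst (λ c → G c ≡ true) (injective e a′≡a) Ga′

  -- If a list exhausts `A`, positions in it count `A`; otherwise an element outside the list so far
  -- can always be chosen.
  infinite⊎countable : (A : Set) → (ℕ ↣ A) ⊎ Countable A
  infinite⊎countable A with em {∃[ l ] (∀ (a : A) → a ∈ₗ l)}
  ... | yes (l , all) = inj₂ (mk↣ {to = toℕ ∘ Any.index ∘ all} λ {a} {b} eq →
      trans (lookup-index (all a)) (trans (cong (lookup l) (toℕ-injective eq)) (sym (lookup-index (all b)))))
  ... | no ¬all = inj₁ (mk↣ {to = new} new-injective)
    where
    fresh : ∀ l → ∃[ a ] a ∉ₗ l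
    fresh l = decidable-stable em λ ¬fresh →
      ¬all (l , λ a → decidable-stable em λ a∉l → ¬fresh (a , a∉l))

    used : ℕ → List A
    used zero      = []
    used (ℕ.suc n) = proj₁ (fresh (used n)) ∷ used n

    new : ℕ → A
    new n = proj₁ (fresh (used n))

    new∈used : ∀ {m n} → m < n → new m ∈ₗ used n
    new∈used {n = ℕ.suc n} m<1+n with m<1+n⇒m<n∨m≡n m<1+n
    ... | inj₁ m<n  = there (new∈used m<n)
    ... | inj₂ refl = here refl

    new-injective : ∀ {m n} → new m ≡ new n → m ≡ n
    new-injective {m} {n} eq with <-cmp m n
    ... | tri< m<n _ _ = contradiction (subst (_∈ₗ used n) eq (new∈used m<n)) (proj₂ (fresh (used n)))
    ... | tri≈ _ m≡n _ = m≡n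
    ... | tri> _ _ n<m = contradiction (subst (_∈ₗ used m) (sym eq) (new∈used n<m)) (proj₂ (fresh (used m)))

  -- Countably many copies of an infinite set embed in it.

  -- Removing from A, transfinitely, one infinite sequence at a time covers A by
  -- disjoint sequences up to a countable remainder.  Tower is the class of
  -- subsets exhausted at some stage of this recursion.

  module Absorption {A : Set} (ℕ↣A : ℕ ↣ A) where

    -- Boolean values turn mutual inclusion into propositional equality.
    Subset : Set
    Subset = A → Bool

    infix 4 _∈ˢ_ _∉ˢ_ _⊑_

    _∈ˢ_ _∉ˢ_ : A → Subset → Set
    x ∈ˢ S = S x ≡ true
    x ∉ˢ S = ¬ x ∈ˢ S

    _⊑_ : Subset → Subset → Set
    S ⊑ R = ∀ x → x ∈ˢ S → x ∈ˢ R

    ⊑-antisym : ∀ {S R} → S ⊑ R → R ⊑ S → S ≡ R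
    ⊑-antisym S⊑R R⊑S = ext λ x → bool-ext (S⊑R x) (R⊑S x)

    Outside : Subset → (ℕ → A) → Set
    Outside S f = (∀ {m n} → f m ≡ f n → m ≡ n) × (∀ n → f n ∉ˢ S)

    -- A junk sequence when no injective sequence outside S exists.

    pick : Subset → ℕ → A
    pick S with em {∃ (Outside S)}
    ... | yes (f , _) = f
    ... | no _        = to ℕ↣A

    Extendable : Subset → Set
    Extendable S = Outside S (pick S)

    extendable : ∀ {S} → ∃ (Outside S) → Extendable S
    extendable {S} f-out with em {∃ (Outside S)}
    ... | yes (_ , out) = out
    ... | no ¬f-out     = contradiction f-out ¬f-out

    -- The successor stage, equal to `S` when no injective sequence outside `S` remains.
    data _∈⁺_ (x : A) (S : Subset) : Set where
      old : x ∈ˢ S → x ∈⁺ S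
      new : Extendable S → ∀ n → pick S n ≡ x → x ∈⁺ S

    -- The union of the successors of a family: an empty family gives the empty set, a singleton a
    -- successor, others the limits.
    data Tower : Subset → Set₁ where
      sup : {I : Set} (F : I → Subset) → (∀ i → Tower (F i)) →
            Tower (λ x → χ (∃[ i ] x ∈⁺ F i))

    _⁺⊑_ : Subset → Subset → Set
    S ⁺⊑ R = ∀ x → x ∈⁺ S → x ∈ˢ R

    -- Stages form a chain with nothing strictly between a stage and its successor. Induction on
    -- both towers, exchanging their roles: if some successor of `F i` is not inside `R`, then `R`
    -- lies in `F i`, and is either equal to it or has its successor inside it.
    compare : ∀ {S R} → Tower S → Tower R → S ⊑ R ⊎ R ⁺⊑ S
    compare {S} {R} (sup F t) r with em {∃[ i ] ¬ F i ⁺⊑ R}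
    ... | no  all = inj₁ λ x x∈S →
      let i , x∈⁺F = χ-elim x∈S
      in decidable-stable em λ x∉R → all (i , λ F⁺⊑R → x∉R (F⁺⊑R x x∈⁺F))
    ... | yes (i , F⁺⋢R) with compare r (t i)
    ...   | inj₂ F⁺⊑R = contradiction F⁺⊑R F⁺⋢R
    ...   | inj₁ R⊑F with compare (t i) r
    ...     | inj₁ F⊑R  = inj₂ λ x x∈⁺R → χ-intro (i , subst (x ∈⁺_) (⊑-antisym R⊑F F⊑R) x∈⁺R)
    ...     | inj₂ R⁺⊑F = inj₂ λ x x∈⁺R → χ-intro (i , old (R⁺⊑F x x∈⁺R))

    Stage : Subset → Set₁
    Stage S = Tower S × Extendable S

    -- Otherwise `S` contains the whole sequence picked for `R`, including the shared element, which
    -- lies outside `S`.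
    stage-⊑ : ∀ {S R m n} → Stage S → Stage R → pick S m ≡ pick R n → S ⊑ R
    stage-⊑ {m = m} {n} (s , _ , out) (r , ext-R) eq with compare s r
    ... | inj₁ S⊑R  = S⊑R
    ... | inj₂ R⁺⊑S = contradiction (R⁺⊑S _ (new ext-R n (sym eq))) (out m)

    pick-injective : ∀ {S R m n} → Stage S → Stage R → pick S m ≡ pick R n → S ≡ R × m ≡ n
    pick-injective s r eq with refl ← ⊑-antisym (stage-⊑ s r eq) (stage-⊑ r s (sym eq)) =
      refl , proj₁ (proj₂ s) eq

    entry : ∀ {S x} → Tower S → x ∈ˢ S → ∃[ R ] Stage R × ∃[ n ] pick R n ≡ x
    entry (sup F t) x∈S with χ-elim x∈S
    ... | i , old x∈F     = entry (t i) x∈F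
    ... | i , new e n n≡x = F i , (t i , e) , n , n≡x

    initial : ∃[ S ] Stage S
    initial = _ , sup {I = ⊥} (λ ()) (λ ()) , extendable (to ℕ↣A , injective ℕ↣A , λ n n∈ → proj₁ (χ-elim n∈))

    -- `Tower S` lives in `Set₁`; its decided truth value is small, so all towers together can index
    -- one application of `sup`.
    Towers : Set
    Towers = Σ Subset λ S → True (em₁ {Tower S})

    final : Subset
    final x = χ (Σ Towers λ (S , _) → x ∈⁺ S)

    final-tower : Tower final
    final-tower = sup {I = Towers} proj₁ (toWitness ∘ proj₂)

    Rest : Set
    Rest = ∃[ x ] final x ≡ false

    ∉final : ∀ {x} → final x ≡ false → x ∉ˢ final
    ∉final x∉ x∈ with () ← trans (sym x∈) x∉

    -- An infinite remainder would make `final` extendable. But `final` is itself a tower, so it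
    -- contains its own successor and hence a picked element outside it.
    rest-countable : Countable Rest
    rest-countable with infinite⊎countable Rest
    ... | inj₂ c = c
    ... | inj₁ f = contradiction (χ-intro ((final , fromWitness final-tower) , new e 0 refl)) (proj₂ e 0)
      where
      e : Extendable final
      e = extendable ( proj₁ ∘ to f
                     , (λ eq → injective f (Rest-≡ eq))
                     , λ n → ∉final (proj₂ (to f n)))
        where
        Rest-≡ : {x y : Rest} → proj₁ x ≡ proj₁ y → x ≡ y
        Rest-≡ {_ , p} {_ , q} refl = cong (_ ,_) (Decidable⇒UIP.≡-irrelevant _≟ᵇ_ p q)

    -- The tags 0 and 1 keep the members of the sequence of `S` apart from remainder elements housed
    -- with it.
    data Placed (x : A) (S : Subset) : ℕ → Set where
      inside  : ∀ n → pick S n ≡ x → Placed x S (pair 0 n)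
      outside : (x∉ : final x ≡ false) → Placed x S (pair 1 (to rest-countable (x , x∉)))

    placed-unique : ∀ {x y S i j} → Placed x S i → Placed y S j → i ≡ j → x ≡ y
    placed-unique (inside m p) (inside n q) eq with refl ← proj₂ (pair-injective eq) =
      trans (sym p) q
    placed-unique (inside m _) (outside _) eq with () ← proj₁ (pair-injective eq)
    placed-unique (outside x∉) (inside n _) eq with () ← proj₁ (pair-injective eq)
    placed-unique (outside x∉) (outside y∉) eq =
      cong proj₁ (injective rest-countable (proj₂ (pair-injective eq)))

    place : ∀ x → ∃[ S ] Stage S × ∃[ i ] Placed x S i
    place x with final x in eq
    ... | false = let S , stage = initial in S , stage , _ , outside eq
    ... | true  = let S , stage , n , p = entry final-tower eq in S , stage , _ , inside n p

    -- Copy `m` of an element placed at `i` goes to entry `pair m i` of the same sequence. Sequences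
    -- of distinct stages are disjoint, so the stage and both indices can be read off.
    absorb : (ℕ × A) ↣ A
    absorb = mk↣ {to = λ (m , x) → let S , _ , i , _ = place x in pick S (pair m i)}
      λ { {m , x} {n , y} eq → absorb-injective m n (place x) (place y) eq }
      where
      absorb-injective : ∀ m n {x y}
        ((S , _ , i , _) : ∃[ S ] Stage S × ∃[ i ] Placed x S i)
        ((R , _ , j , _) : ∃[ R ] Stage R × ∃[ j ] Placed y R j) →
        pick S (pair m i) ≡ pick R (pair n j) → (m , x) ≡ (n , y)
      absorb-injective m n (S , s , i , p) (R , r , j , q) eq
        with refl , eq′ ← pick-injective s r eq =
        let m≡n , i≡j = pair-injective eq′ in cong₂ _,_ m≡n (placed-unique p q i≡j)

  -- The spaces attached to subsets of κ.

  module Uncountable (κ : Set) (uncountable : ¬ Countable κ) (e : κ ↣ (ℕ → Bool)) where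

    ℕ↣κ : ℕ ↣ κ
    ℕ↣κ = fromInj₁ (λ c → contradiction c uncountable) (infinite⊎countable κ)

    k₀ : κ
    k₀ = to ℕ↣κ 0

    -- The letters following s record s, so that (s , k) can be recovered.

    tail : List ℕ × κ → ℕ → ℕ
    tail (s , k) j = pair (code s) (bit (to e k j))

    point : List ℕ × κ → ℕ → ℕ
    point w = proj₁ w ⌢ tail w

    -- The letter at `length s + length t` lies past both stems, so it records both codes.
    stem-determined : ∀ {s t k l} → (∀ j → point (s , k) j ≡ point (t , l) j) → s ≡ t
    stem-determined {s} {t} {k} {l} eq = code-injective (proj₁ (pair-injective (begin
      tail (s , k) (length t)              ≡⟨ ⌢-drop s _ (length t) ⟨
      point (s , k) (length s + length t)  ≡⟨ eq _ ⟩
      point (t , l) (length s + length t)  ≡⟨ cong (point (t , l)) (+-comm (length s) (length t)) ⟩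
      point (t , l) (length t + length s)  ≡⟨ ⌢-drop t _ (length s) ⟩
      tail (t , l) (length s)              ∎)))
      where open ≡-Reasoning

    index-determined : ∀ {s k l} → (∀ j → point (s , k) j ≡ point (s , l) j) → k ≡ l
    index-determined {s} {k} {l} eq = injective e (ext λ j →
      bit-injective (proj₂ (pair-injective (begin
        tail (s , k) j                ≡⟨ ⌢-drop s _ j ⟨
        point (s , k) (length s + j)  ≡⟨ eq _ ⟩
        point (s , l) (length s + j)  ≡⟨ ⌢-drop s _ j ⟩
        tail (s , l) j                ∎))))
      where open ≡-Reasoning

    point-injective : ∀ {w v} → (∀ j → point w j ≡ point v j) → w ≡ v
    point-injective {s , k} {t , l} eq with refl ← stem-determined {s} {t} eq =
      cong (s ,_) (index-determined {s} eq)

    -- Points with a nonempty stem belong to every space; only those with the empty stem encode `A`.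
    present : (κ → Bool) → List ℕ × κ → Bool
    present A ([]    , k) = A k
    present A (_ ∷ _ , k) = true

    Point : (κ → Bool) → Set
    Point A = ∃[ w ] T (present A w)

    ι : ∀ {A} → Point A → ℕ → ℕ
    ι = point ∘ proj₁

    Point-≡ : ∀ {A} {x y : Point A} → proj₁ x ≡ proj₁ y → x ≡ y
    Point-≡ {x = _ , p} {_ , q} refl = cong (_ ,_) (T-irrelevant p q)

    ι-injective : ∀ {A} {x y : Point A} → (∀ j → ι x j ≡ ι y j) → x ≡ y
    ι-injective = Point-≡ ∘ point-injective

    module X (A : κ → Bool) = Induced (ι {A})

    -- A prefix of n+1 rather than n letters is never empty, so the point is present whatever `A`
    -- is.
    near : ∀ {A} → ℕ → Point A → κ → Point A
    near n x k = (prefix (ℕ.suc n) (ι x) , k) , _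

    near-agrees : ∀ {A} n (x : Point A) k → X.Agree A n x (near n x k)
    near-agrees n x k j j<n = prefix-⌢ {ℕ.suc n} (ι x) _ j (m<n⇒m<1+n j<n)

    Point↣κ : ∀ {A} → Point A ↣ κ
    Point↣κ = Absorption.absorb ℕ↣κ ↣-∘ mk↣ {to = λ ((s , k) , _) → code s , k} λ eq →
      Point-≡ (cong₂ _,_ (code-injective (cong proj₁ eq)) (cong proj₂ eq))

    isBASpace : ∀ A → IsBASpace κ (X.space A)
    isBASpace A = record
      { separable       = D , D-countable , D-dense
      ; metrizable      = X.metrizable A ι-injective
      ; zeroDimensional = X.zeroDimensional A
      ; crowded         = ((0 ∷ [] , k₀) , _) , open-size
      }
      where
      D : Pred (Point A) 0ℓ
      D ((_ , k) , _) = k ≡ k₀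

      D-countable : Countable (Refinement (Point A) D)
      D-countable = mk↣ {to = λ (((s , _) , _) , _) → code s}
        λ { {((s , k) , _) , [ k≡k₀ ]} {((t , l) , _) , [ l≡k₀ ]} eq →
            Refinement-≡ (Point-≡ (cong₂ _,_ (code-injective eq)
              -- Membership in a `Refinement` is irrelevant; excluded middle recovers usable
              -- equations.
              (trans (recompute em k≡k₀) (sym (recompute em l≡k₀))))) }
        where
        Refinement-≡ : {x y : Refinement (Point A) D} → value x ≡ value y → x ≡ y
        Refinement-≡ refl = refl

      D-dense : ∀ V → Space.Open (X.space A) V → Satisfiable V → Satisfiable (λ x → x ∈ D × x ∈ V)
      D-dense V V-open (x , x∈V) =
        let n , c = V-open x x∈V in near n x k₀ , refl , c _ (near-agrees n x k₀)

      open-size : ∀ V → Space.Open (X.space A) V → Satisfiable V → Refinement (Point A) V ↔ κ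
      open-size V V-open (x , x∈V) = cantorSchröderBernstein
        (Point↣κ ↣-∘ mk↣ {to = value} value-injective)
        -- One cylinder inside `V` already holds a point for each index in κ.
        (let n , c = V-open x x∈V
         in mk↣ {to = λ k → near n x k , [ c _ (near-agrees n x k) ]} λ { refl → refl })

    -- Counting subsets of κ by homeomorphisms.

    module _ (ba : BA⁻ κ) where

      base : κ → Bool
      base _ = true

      module H (A : κ → Bool) = Homeomorphic (ba (X.space base) (X.space A) (isBASpace base) (isBASpace A))
      module h (A : κ → Bool) = Inverse (H.bijection A)

      dense : List ℕ → Point base
      dense []      = ([] , k₀) , _
      dense (a ∷ s) = (a ∷ s , k₀) , _

      -- A continuous map is determined by the letters of its values on a
      -- countable dense set.

      profile : (κ → Bool) → List ℕ × ℕ × ℕ → Bool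
      profile A (s , j , v) = χ (ι (h.to A (dense s)) j ≡ v)

      locally-constant : ∀ A (x : Point base) j →
        ∃[ n ] (∀ y → X.Agree base n x y → ι (h.to A x) j ≡ ι (h.to A y) j)
      locally-constant A x j =
        -- The open set consists of the points sharing letter `j` with the image of `x`; j+1 letters
        -- decide membership.
        H.to-continuous A _ (λ y x~y → ℕ.suc j , λ z y~z → trans x~y (y~z j (s≤s ≤-refl))) x refl

      -- Near `x`, letter `j` of both images is constant, so it can be read at a single dense point
      -- close enough for both maps.
      profile⇒image : ∀ {A B} → profile A ≡ profile B →
        ∀ x → proj₁ (h.to A x) ≡ proj₁ (h.to B x)
      profile⇒image {A} {B} eq x = point-injective λ j →
        let m , c = locally-constant A x j
            n , d = locally-constant B x j
            s     = prefix (ℕ.suc (m ⊔ n)) (ι x)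
            x~s   = near-agrees (m ⊔ n) x k₀
        in begin
          ι (h.to A x) j          ≡⟨ c (dense s) (X.Agree-mono base {x = x} {dense s} (m≤m⊔n m n) x~s) ⟩
          -- The omitted value is the letter for `B`: the profile of `B` is true there, hence so is
          -- that of `A`.
          ι (h.to A (dense s)) j  ≡⟨ χ-elim (trans (cong-app eq (s , j , _)) (χ-intro refl)) ⟩
          ι (h.to B (dense s)) j  ≡⟨ d (dense s) (X.Agree-mono base {x = x} {dense s} (m≤n⊔m m n) x~s) ⟨
          ι (h.to B x) j          ∎
        where open ≡-Reasoning

      -- The point with empty stem and index `k` is an image under the homeomorphism for `A`, hence
      -- under that for `B`, so it is present for `B`.
      profile⇒⊆ : ∀ {A B} → profile A ≡ profile B → ∀ k → A k ≡ true → B k ≡ true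
      profile⇒⊆ {A} {B} eq k Ak = Equivalence.to T-≡
        (subst (T ∘ present B) eq′ (proj₂ (h.to B x)))
        where
        x : Point base
        x = h.from A (([] , k) , Equivalence.from T-≡ Ak)

        eq′ : proj₁ (h.to B x) ≡ ([] , k)
        eq′ = trans (sym (profile⇒image eq x)) (cong proj₁ (h.strictlyInverseˡ A _))

      profile-injective : (κ → Bool) ↣ (List ℕ × ℕ × ℕ → Bool)
      profile-injective = mk↣ {to = profile} λ eq → ext λ k →
        bool-ext (profile⇒⊆ eq k) (profile⇒⊆ (sym eq) k)

      triple : (List ℕ × ℕ × ℕ) ↣ ℕ
      triple = mk↣ {to = λ (s , j , v) → pair (code s) (pair j v)} λ {(s , j , v)} eq →
        let s≡ , jv≡ = pair-injective eq
            j≡ , v≡  = pair-injective jv≡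
        in cong₂ _,_ (code-injective s≡) (cong₂ _,_ j≡ v≡)

      continuum : (ℕ → Bool) ↔ (κ → Bool)
      continuum = cantorSchröderBernstein
        (Bool^-mono ℕ↣κ)
        (Bool^-mono triple ↣-∘ profile-injective)

lemma3p1 : ExcludedMiddle (suc 0ℓ) → Extensionality 0ℓ 0ℓ →
    (κ : Set) → ¬ Countable κ → κ ↣ (ℕ → Bool) →
    BA⁻ κ → (ℕ → Bool) ↔ (κ → Bool)
lemma3p1 em₁ ext κ uncountable e ba = Uncountable.continuum em₁ ext κ uncountable e ba
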